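{- Let $\mathcal I$ be an interpretation of a circuit signature $\Sigma$. For every sequential circuit $f\colon m\to n$ there exist $x\in\mathbb N$, at least one combinational circuit $g\colon x+m\to x+n$, and values $\overline s\in\mathbf V^x$ such that $f\rightsquigarrow^{*}\mathrm{Tr}^x\big((\mathrm{reg}(\overline s)\otimes\mathrm{id}_m);g\big)$ by applying the rule (Mealy) followed by the rule (IF).
   Context: Circuits. A circuit signature $\Sigma$ consists of a finite set $\mathbf V$ of values with a distinguished value $\bullet$, a set $\mathcal P$ of primitive symbols, and functions $\mathrm{dom},\mathrm{cod}\colon\mathcal P\to\mathbb N$. A PROP is a strict symmetric monoidal category with objects $\mathbb N$ and addition as tensor on objects. $\mathbf{CCirc}_\Sigma$ is the PROP freely generated by: $p\colon\mathrm{dom}(p)\to\mathrm{cod}(p)$ for $p\in\mathcal P$, a fork $1\to2$, a join $2\to1$, an introduction $\bullet\colon0\to1$, and an elimination $1\to0$; its morphisms are combinational circuits. $\mathbf{SCirc}_\Sigma$ is the symmetric traced PROP freely generated by these together with a value $v\colon0\to1$ for each $v\in\mathbf V\setminus\{\bullet\}$ and a delay $\delta\colon1\to1$ (the "value" $\bullet$ means the introduction generator); its morphisms are sequential circuits, taken modulo the axioms of symmetric traced monoidal categories. Composition $f;g$ is in diagrammatic order; $\mathrm{Tr}^x$ sends $x+m\to x+n$ to $m\to n$. $\mathrm{fork}_n,\mathrm{join}_n,\mathrm{elim}_n,\bullet_n,\delta_n$ and $\overline v\colon0\to n$ ($\overline v\in\mathbf V^n$) are the wirewise versions on $n$ wires;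 $\mathrm{reg}(\overline v)\coloneqq(\overline v\otimes\delta_n);\mathrm{join}_n\colon n\to n$. An interpretation $\mathcal I$ is a lattice order on $\mathbf V$ with $\bullet$ least (also written $\bot$), and for each $p\in\mathcal P$ a $\bot$-preserving monotone function $\mathbf V^{\mathrm{dom}(p)}\to\mathbf V^{\mathrm{cod}(p)}$. Rule (Mealy). For combinational $\hat f\colon x+y+z+m\to x+y+n$ and $\overline v\in\mathbf V^z$: a circuit in global trace-delay form $\mathrm{Tr}^{x+y}\big((\mathrm{id}_x\otimes\delta_y\otimes\overline v\otimes\mathrm{id}_m);\hat f\big)$ rewrites to $\mathrm{Tr}^{x+y+z}\big((\mathrm{id}_x\otimes\mathrm{reg}(\bot^y\overline v)\otimes\mathrm{id}_m);\hat f;(\mathrm{id}_{x+y}\otimes\bullet_z\otimes\mathrm{id}_n)\big)$, a circuit in pre-Mealy form $\mathrm{Tr}^{x+p}\big((\mathrm{id}_x\otimes\mathrm{reg}(\overline s)\otimes\mathrm{id}_m);h\big)$ with $h$ combinational and $\overline s=\bot^y\overline v$. Rule (IF). For combinational $h\colon x+a\to x+b$: $\mathrm{Tr}^x(h)\rightsquigarrow h^\dagger;(\mathrm{elim}_x\otimes\mathrm{id}_b)$. Here $h^0\coloneqq(\bullet_x\otimes\mathrm{id}_a);h$, $h^{k+1}\coloneqq\mathrm{fork}_a;\big((h^k;(\mathrm{id}_x\otimes\mathrm{elim}_b))\otimes\mathrm{id}_a\big);h$, and $h^\dagger\coloneqq h^{c+1}$ with $c$ the length of the longest chain in $\mathbf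 V^x$. Rules may be applied to subcircuits, modulo axioms of symmetric traced monoidal categories. -}

module Defs where

open import Data.Nat using (ℕ; zero; suc; _+_; _≤_)
open import Data.Nat.Properties using (+-assoc; +-identityʳ)
open import Data.Fin using (Fin) renaming (_<_ to _<ᶠ_)
open import Data.Fin.Properties using (inj⇒≟)
open import Data.Vec using (Vec; []; _∷_; _++_; replicate)
open import Data.Vec.Relation.Binary.Pointwise.Inductive using (Pointwise)
open import Data.Product using (_×_; _,_; ∃; ∃-syntax; proj₂)
open import Function.Bundles using (_↔_)
open import Function.Properties.Inverse using (↔⇒↣)
open import Level using (0ℓ)
open import Relation.Binary.Core using (Rel; _Preserves_⟶_)
open import Relation.Binary.Definitions using (DecidableEquality; Minimum)
open import Relation.Binary.Lattice.Structures using (IsLattice)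
open import Relation.Binary.PropositionalEquality using (_≡_; _≢_; refl; sym; trans; cong; subst₂)
open import Relation.Nullary using (yes; no)
import Relation.Binary.Construct.NonStrictToStrict as ToStrict

------------------------------------------------------------------------
-- Free PROPs and free symmetric traced PROPs

data Kind : Set where
  plain traced : Kind

-- Terms over a family G of generators.  Morphisms of the free PROP
-- (plain) and of the free symmetric traced PROP (traced) are terms
-- modulo _≈_ below.
data Term (G : ℕ → ℕ → Set) : Kind → ℕ → ℕ → Set where
  gen : ∀ {k m n} → G m n → Term G k m n
  id  : ∀ {k} n → Term G k n n
  _⨾_ : ∀ {k l m n} → Term G k l m → Term G k m n → Term G k l n
  _⊗_ : ∀ {k m n p q} → Term G k m n → Term G k p q → Term G k (m + p) (n + q)
  σ   : ∀ {k} m n → Term G k (m + n) (n + m)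
  Tr  : ∀ x {m n} → Term G traced (x + m) (x + n) → Term G traced m n

infixr 5 _⨾_
infixr 6 _⊗_
infix  4 _≈_

-- Objects such as (l + m) + n and l + (m + n) are equal in a PROP; as
-- they are not convertible, strictness is mediated by transport.
cast : ∀ {G k m m′ n n′} → m ≡ m′ → n ≡ n′ → Term G k m n → Term G k m′ n′
cast {G} {k} = subst₂ (Term G k)

-- Note that 0 + n reduces to n, so the left unit law and vanishing at 0
-- need no transport.
data _≈_ {G : ℕ → ℕ → Set} : ∀ {k m n} → Term G k m n → Term G k m n → Set where
  ≈-refl  : ∀ {k m n} {f : Term G k m n} → f ≈ f
  ≈-sym   : ∀ {k m n} {f g : Term G k m n} → f ≈ g → g ≈ f
  ≈-trans : ∀ {k m n} {f g h : Term G k m n} → f ≈ g → g ≈ h → f ≈ h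
  ⨾-cong  : ∀ {k l m n} {f f′ : Term G k l m} {g g′ : Term G k m n} →
            f ≈ f′ → g ≈ g′ → f ⨾ g ≈ f′ ⨾ g′
  ⊗-cong  : ∀ {k m n p q} {f f′ : Term G k m n} {g g′ : Term G k p q} →
            f ≈ f′ → g ≈ g′ → f ⊗ g ≈ f′ ⊗ g′
  Tr-cong : ∀ {x m n} {f f′ : Term G traced (x + m) (x + n)} →
            f ≈ f′ → Tr x f ≈ Tr x f′

  -- category
  ⨾-identityˡ : ∀ {k m n} (f : Term G k m n) → id m ⨾ f ≈ f
  ⨾-identityʳ : ∀ {k m n} (f : Term G k m n) → f ⨾ id n ≈ f
  ⨾-assoc     : ∀ {k l m n o} (f : Term G k l m) (g : Term G k m n) (h : Term G k n o) →
                (f ⨾ g) ⨾ h ≈ f ⨾ (g ⨾ h)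

  -- strict monoidal category
  ⊗-id          : ∀ {k} m n → id {k = k} m ⊗ id n ≈ id (m + n)
  ⊗-interchange : ∀ {k l m n p q r}
                  (f : Term G k l m) (g : Term G k m n)
                  (f′ : Term G k p q) (g′ : Term G k q r) →
                  (f ⨾ g) ⊗ (f′ ⨾ g′) ≈ (f ⊗ f′) ⨾ (g ⊗ g′)
  ⊗-identityˡ   : ∀ {k m n} (f : Term G k m n) → id 0 ⊗ f ≈ f
  ⊗-identityʳ   : ∀ {k m n} (f : Term G k m n) →
                  cast (+-identityʳ m) (+-identityʳ n) (f ⊗ id 0) ≈ f
  ⊗-assoc       : ∀ {k m m′ n n′ p p′}
                  (f : Term G k m m′) (g : Term G k n n′) (h : Term G k p p′) →
                  cast (+-assoc m n p) (+-assoc m′ n′ p′) ((f ⊗ g) ⊗ h) ≈ f ⊗ (g ⊗ h)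

  -- symmetry
  σ-natural    : ∀ {k m n p q} (f : Term G k m n) (g : Term G k p q) →
                 (f ⊗ g) ⨾ σ n q ≈ σ m p ⨾ (g ⊗ f)
  σ-involutive : ∀ {k} m n → σ {k = k} m n ⨾ σ n m ≈ id (m + n)
  σ-unit       : ∀ {k} n → cast refl (+-identityʳ n) (σ {k = k} 0 n) ≈ id n
  σ-hexagon    : ∀ {k} m n p →
                 cast (sym (+-assoc m n p)) (+-assoc n p m) (σ {k = k} m (n + p))
                 ≈ (σ m n ⊗ id p) ⨾ cast (sym (+-assoc n m p)) refl (id n ⊗ σ m p)

  -- trace
  Tr-tightening  : ∀ {x l m n o} (g : Term G traced l m)
                   (f : Term G traced (x + m) (x + n)) (h : Term G traced n o) →
                   Tr x ((id x ⊗ g) ⨾ f ⨾ (id x ⊗ h)) ≈ g ⨾ Tr x f ⨾ h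
  Tr-sliding     : ∀ {x y m n} (f : Term G traced (x + m) (y + n)) (g : Term G traced y x) →
                   Tr x (f ⨾ (g ⊗ id n)) ≈ Tr y ((g ⊗ id m) ⨾ f)
  Tr-vanishing₀  : ∀ {m n} (f : Term G traced m n) → Tr 0 f ≈ f
  Tr-vanishing₊  : ∀ {x y m n} (f : Term G traced (x + (y + m)) (x + (y + n))) →
                   Tr (x + y) (cast (sym (+-assoc x y m)) (sym (+-assoc x y n)) f)
                   ≈ Tr y (Tr x f)
  Tr-superposing : ∀ {x m n p q} (f : Term G traced (x + m) (x + n)) (g : Term G traced p q) →
                   Tr x (cast (+-assoc x m p) (+-assoc x n q) (f ⊗ g)) ≈ Tr x f ⊗ g
  Tr-yanking     : ∀ x → Tr x (σ x x) ≈ id x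

------------------------------------------------------------------------
-- Circuits

record Signature : Set₁ where
  field
    V        : Set
    V-finite : ∃ λ n → V ↔ Fin n
    •        : V
    P        : Set
    dom cod  : P → ℕ

  _≟ⱽ_ : DecidableEquality V
  _≟ⱽ_ = inj⇒≟ (↔⇒↣ (proj₂ V-finite))

module Circuits (S : Signature) where
  open Signature S

  data CGen : ℕ → ℕ → Set where
    prim  : (p : P) → CGen (dom p) (cod p)
    fork  : CGen 1 2
    join  : CGen 2 1
    intro : CGen 0 1
    elim  : CGen 1 0

  data SGen : ℕ → ℕ → Set where
    comb  : ∀ {m n} → CGen m n → SGen m n
    -- One generator per v: all proofs of v ≢ • are definitionally equal.
    value : (v : V) → v ≢ • → SGen 0 1
    delay : SGen 1 1

  CCirc SCirc : ℕ → ℕ → Set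
  CCirc = Term CGen plain
  SCirc = Term SGen traced

  ⌜_⌝ : ∀ {m n} → CCirc m n → SCirc m n
  ⌜ gen g ⌝ = gen (comb g)
  ⌜ id n ⌝  = id n
  ⌜ f ⨾ g ⌝ = ⌜ f ⌝ ⨾ ⌜ g ⌝
  ⌜ f ⊗ g ⌝ = ⌜ f ⌝ ⊗ ⌜ g ⌝
  ⌜ σ m n ⌝ = σ m n

  forks : ∀ n → CCirc n (n + n)
  forks zero    = id 0
  forks (suc n) = (gen fork ⊗ forks n) ⨾
                  (id 1 ⊗ cast refl (+-assoc n 1 n) (σ 1 n ⊗ id n))

  joins : ∀ n → CCirc (n + n) n
  joins zero    = id 0
  joins (suc n) = (id 1 ⊗ cast (+-assoc n 1 n) refl (σ n 1 ⊗ id n)) ⨾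
                  (gen join ⊗ joins n)

  elims : ∀ n → CCirc n 0
  elims zero    = id 0
  elims (suc n) = gen elim ⊗ elims n

  intros : ∀ n → CCirc 0 n
  intros zero    = id 0
  intros (suc n) = gen intro ⊗ intros n

  delays : ∀ n → SCirc n n
  delays zero    = id 0
  delays (suc n) = gen delay ⊗ delays n

  val : V → SCirc 0 1
  val v with v ≟ⱽ •
  ... | yes _  = gen (comb intro)
  ... | no v≢• = gen (value v v≢•)

  vals : ∀ {n} → Vec V n → SCirc 0 n
  vals []       = id 0
  vals (v ∷ vs) = val v ⊗ vals vs

  reg : ∀ {n} → Vec V n → SCirc n n
  reg {n} vs = (vals vs ⊗ delays n) ⨾ ⌜ joins n ⌝

  ----------------------------------------------------------------------
  -- Rewriting

  Rule : Set₁
  Rule = ∀ {m n} → SCirc m n → SCirc m n → Set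

  data InContext (R : Rule) : ∀ {m n} → SCirc m n → SCirc m n → Set where
    here : ∀ {m n} {f g : SCirc m n} → R f g → InContext R f g
    ⨾ˡ   : ∀ {l m n} {f f′ : SCirc l m} → InContext R f f′ →
           (g : SCirc m n) → InContext R (f ⨾ g) (f′ ⨾ g)
    ⨾ʳ   : ∀ {l m n} (f : SCirc l m) {g g′ : SCirc m n} →
           InContext R g g′ → InContext R (f ⨾ g) (f ⨾ g′)
    ⊗ˡ   : ∀ {m n p q} {f f′ : SCirc m n} → InContext R f f′ →
           (g : SCirc p q) → InContext R (f ⊗ g) (f′ ⊗ g)
    ⊗ʳ   : ∀ {m n p q} (f : SCirc m n) {g g′ : SCirc p q} →
           InContext R g g′ → InContext R (f ⊗ g) (f ⊗ g′)
    tr   : ∀ x {m n} {f f′ : SCirc (x + m) (x + n)} →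
           InContext R f f′ → InContext R (Tr x f) (Tr x f′)

  -- One application of R to a subcircuit, modulo the axioms of symmetric
  -- traced monoidal categories.
  _⇝[_]_ : ∀ {m n} → SCirc m n → Rule → SCirc m n → Set
  f ⇝[ R ] g = ∃[ f′ ] ∃[ g′ ] (f ≈ f′ × InContext R f′ g′ × g′ ≈ g)

  infix 4 _⇝[_]_

  regroup : ∀ x y z m → (x + y) + (z + m) ≡ (x + (y + z)) + m
  regroup x y z m = trans (sym (+-assoc (x + y) z m)) (cong (_+ m) (+-assoc x y z))

  data Mealy : Rule where
    mealy : ∀ x y {z m n} (v : Vec V z) (f̂ : CCirc ((x + y) + (z + m)) ((x + y) + n)) →
            Mealy (Tr (x + y) (((id x ⊗ delays y) ⊗ (vals v ⊗ id m)) ⨾ ⌜ f̂ ⌝))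
                  (Tr (x + (y + z))
                    (((id x ⊗ reg (replicate y • ++ v)) ⊗ id m) ⨾
                     ⌜ cast (regroup x y z m) (regroup x y z n)
                         (f̂ ⨾ (id (x + y) ⊗ (intros z ⊗ id n))) ⌝))

  iterate : ∀ x {a b} → CCirc (x + a) (x + b) → ℕ → CCirc a (x + b)
  iterate x {a} {b} h zero    = (intros x ⊗ id a) ⨾ h
  iterate x {a} {b} h (suc k) =
    forks a ⨾
    (cast refl (+-identityʳ x) (iterate x h k ⨾ (id x ⊗ elims b)) ⊗ id a) ⨾
    h

  record Interpretation : Set₁ where
    field
      _⊑_       : Rel V 0ℓ
      _⊔_ _⊓_   : V → V → V
      isLattice : IsLattice _≡_ _⊑_ _⊔_ _⊓_
      •-least   : Minimum _⊑_ •
      ⟦_⟧       : (p : P) → Vec V (dom p) → Vec V (cod p)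
      ⟦⟧-mono   : ∀ p → ⟦ p ⟧ Preserves Pointwise _⊑_ ⟶ Pointwise _⊑_
      ⟦⟧-⊥      : ∀ p → ⟦ p ⟧ (replicate (dom p) •) ≡ replicate (cod p) •

    _⊏_ : ∀ {n} → Rel (Vec V n) 0ℓ
    _⊏_ = ToStrict._<_ _≡_ (Pointwise _⊑_)

    -- A chain v₀ ⊏ v₁ ⊏ … ⊏ v_c in Vⁿ: as usual in order theory, its
    -- length c is one less than the number of its elements.
    Chain : ℕ → ℕ → Set
    Chain n c = ∃ λ (v : Fin (suc c) → Vec V n) → v Preserves _<ᶠ_ ⟶ _⊏_

    LongestChainLength : ℕ → ℕ → Set
    LongestChainLength n c = Chain n c × (∀ d → Chain n d → d ≤ c)

  -- The number c is determined by x, so this is one rewrite per h.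
  data IF (I : Interpretation) : Rule where
    unfold : ∀ x {a b} (h : CCirc (x + a) (x + b)) {c} →
             Interpretation.LongestChainLength I x c →
             IF I (Tr x ⌜ h ⌝) ⌜ iterate x h (suc c) ⨾ (elims x ⊗ id b) ⌝

-- Every circuit is brought to the form Tr a ((u ⊗ id m) ⨾ F) with F combinational
-- and u a parallel composite of identities, delays and values: a single
-- generator u : a → b is Tr a ((u ⊗ id a) ⨾ σ b a) by yanking and sliding, and
-- such forms are closed under ⨾, ⊗ and Tr.  Wire permutations bring u to
-- id ⊗ delays ⊗ vals up to combinational pre- and postcomposition, and the
-- precomposed part slides around the trace; this is global trace-delay form.
-- After (Mealy), vanishing and tightening turn the trace over x + (y + z) into
-- an outer trace holding the registers and an inner trace over x of a
-- combinational circuit, which is the redex of (IF).  The chain length needed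
-- there exists because ⊏ is decidable on a finite set, where the pigeonhole
-- principle bounds all chains.

{-# OPTIONS --safe #-}
module Submission where

open import Data.Fin using (Fin; zero; suc) renaming (_<_ to _<ᶠ_)
open import Data.Fin.Properties using (any?; pigeonhole; *↔×)
open import Data.Nat using (ℕ; zero; suc; _+_; _^_; _≤_; s≤s; z≤n)
open import Data.Nat.Properties using (+-assoc; +-identityʳ; ≡-irrelevant;
  ≤-pred; ≮⇒≥; ≤∧≢⇒<; m≤n⇒m≤1+n)
open import Data.Product using (Σ-syntax; ∃; ∃-syntax; _×_; _,_; proj₁; proj₂; uncurry)
open import Data.Product.Function.NonDependent.Propositional using (_×-↔_)
open import Data.Unit using (⊤)
open import Data.Vec using (Vec; []; _∷_; _++_; replicate)
open import Data.Vec.Properties using (≡-dec)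
open import Data.Vec.Relation.Binary.Pointwise.Inductive as Pointwise using (Pointwise)
open import Function using (_∘_; _↔_; mk↔ₛ′; module Inverse)
open import Function.Construct.Composition using (_↔-∘_)
open import Function.Construct.Symmetry using (↔-sym)
open import Level using (0ℓ)
open import Relation.Binary using (Rel; Decidable; Transitive; Irreflexive;
  IsPartialOrder; Setoid; _Preserves_⟶_)
open import Relation.Binary.Lattice using (IsLattice; JoinSemilattice)
open import Relation.Binary.Lattice.Properties.JoinSemilattice using (≈-dec⇒≤-dec)
open import Relation.Binary.PropositionalEquality using (_≡_; _≢_; refl; isEquivalence;
  sym; trans; cong; cong₂; subst)
open import Relation.Nullary using (Dec; yes; no; contradiction)
open import Relation.Nullary.Decidable using (map′; _×-dec_)
import Relation.Binary.Construct.NonStrictToStrict as ToStrict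
import Relation.Binary.Reasoning.Setoid as SetoidReasoning
open import Defs

-- Transport of terms along equations between objects.

module _ {G : ℕ → ℕ → Set} where

  ≡⇒≈ : ∀ {k m n} {f g : Term G k m n} → f ≡ g → f ≈ g
  ≡⇒≈ refl = ≈-refl

  cast-cong : ∀ {k m m′ n n′} (p : m ≡ m′) (q : n ≡ n′) {f g : Term G k m n} →
              f ≈ g → cast p q f ≈ cast p q g
  cast-cong refl refl f≈g = f≈g

  cast-sym : ∀ {k m m′ n n′} (p : m ≡ m′) (q : n ≡ n′)
             {f : Term G k m n} {g : Term G k m′ n′} →
             cast p q f ≈ g → cast (sym p) (sym q) g ≈ f
  cast-sym refl refl p = ≈-sym p

  -- By uniqueness of identity proofs. It serves where both bracketings of a sum already reduce to
  -- the same number, as for `+-assoc 1 y y′`, so that the transport in `⊗-assoc` can be inserted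
  -- freely.
  cast-loop : ∀ {k m n} (p : m ≡ m) (q : n ≡ n) (f : Term G k m n) → cast p q f ≡ f
  cast-loop refl refl f = refl

  cast-id : ∀ {k m n} (p q : m ≡ n) → cast {G} p q (id {k = k} m) ≡ id n
  cast-id refl refl = refl

  cast-cast : ∀ {k m m′ m″ n n′ n″} (p : m ≡ m′) (p′ : m′ ≡ m″) (q : n ≡ n′) (q′ : n′ ≡ n″)
              (f : Term G k m n) →
              cast p′ q′ (cast p q f) ≡ cast (trans p p′) (trans q q′) f
  cast-cast refl refl refl refl f = refl

  cast-⨾ : ∀ {k l l′ m m′ n n′} (p : l ≡ l′) (q : m ≡ m′) (r : n ≡ n′)
           (f : Term G k l m) (g : Term G k m n) →
           cast p r (f ⨾ g) ≡ cast p q f ⨾ cast q r g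
  cast-⨾ refl refl refl f g = refl

  cast-⊗ʳ : ∀ {k m n p p′ q q′} (e : p ≡ p′) (e′ : q ≡ q′)
            (f : Term G k m n) (g : Term G k p q) →
            cast (cong (m +_) e) (cong (n +_) e′) (f ⊗ g) ≡ f ⊗ cast e e′ g
  cast-⊗ʳ refl refl f g = refl

  Tr-cast : ∀ {x x′} (e : x ≡ x′) {m n} (f : Term G traced (x + m) (x + n)) →
            Tr x f ≡ Tr x′ (cast (cong (_+ m) e) (cong (_+ n) e) f)
  Tr-cast refl f = refl

  ≈-setoid : Kind → ℕ → ℕ → Setoid _ _
  ≈-setoid k m n = record
    { Carrier       = Term G k m n
    ; _≈_           = _≈_
    ; isEquivalence = record { refl = ≈-refl ; sym = ≈-sym ; trans = ≈-trans }
    }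

module ≈-Reasoning {G k m n} = SetoidReasoning (≈-setoid {G} k m n)
open ≈-Reasoning

-- Derived laws of symmetric traced monoidal categories.

module _ {G : ℕ → ℕ → Set} where

  ⨾-congˡ : ∀ {k l m n} {f : Term G k l m} {g g′ : Term G k m n} → g ≈ g′ → f ⨾ g ≈ f ⨾ g′
  ⨾-congˡ = ⨾-cong ≈-refl

  ⨾-congʳ : ∀ {k l m n} {f f′ : Term G k l m} {g : Term G k m n} → f ≈ f′ → f ⨾ g ≈ f′ ⨾ g
  ⨾-congʳ p = ⨾-cong p ≈-refl

  ⊗-congˡ : ∀ {k m n p q} {f : Term G k m n} {g g′ : Term G k p q} → g ≈ g′ → f ⊗ g ≈ f ⊗ g′
  ⊗-congˡ = ⊗-cong ≈-refl

  ⊗-congʳ : ∀ {k m n p q} {f f′ : Term G k m n} {g : Term G k p q} → f ≈ f′ → f ⊗ g ≈ f′ ⊗ g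
  ⊗-congʳ p = ⊗-cong p ≈-refl

  ⨾-identity : ∀ {k m n} (f : Term G k m n) → id m ⨾ f ⨾ id n ≈ f
  ⨾-identity f = ≈-trans (⨾-identityˡ _) (⨾-identityʳ f)

  ⊗-interchange₃ : ∀ {k l m n o l′ m′ n′ o′}
    (f₁ : Term G k l m) (f₂ : Term G k m n) (f₃ : Term G k n o)
    (g₁ : Term G k l′ m′) (g₂ : Term G k m′ n′) (g₃ : Term G k n′ o′) →
    (f₁ ⨾ f₂ ⨾ f₃) ⊗ (g₁ ⨾ g₂ ⨾ g₃) ≈ (f₁ ⊗ g₁) ⨾ (f₂ ⊗ g₂) ⨾ (f₃ ⊗ g₃)
  ⊗-interchange₃ f₁ f₂ f₃ g₁ g₂ g₃ =
    ≈-trans (⊗-interchange _ _ _ _) (⨾-congˡ (⊗-interchange _ _ _ _))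

  ⊗-distribʳ-⨾ : ∀ {k l m n} p (f : Term G k l m) (g : Term G k m n) →
                 (f ⨾ g) ⊗ id p ≈ (f ⊗ id p) ⨾ (g ⊗ id p)
  ⊗-distribʳ-⨾ p f g = begin
    (f ⨾ g) ⊗ id p             ≈⟨ ⊗-congˡ (⨾-identityˡ (id p)) ⟨
    (f ⨾ g) ⊗ (id p ⨾ id p)    ≈⟨ ⊗-interchange f g (id p) (id p) ⟩
    (f ⊗ id p) ⨾ (g ⊗ id p)    ∎

  ⊗-as-⨾ : ∀ {k m n p q} (f : Term G k m n) (g : Term G k p q) →
           f ⊗ g ≈ (f ⊗ id p) ⨾ (id n ⊗ g)
  ⊗-as-⨾ {n = n} {p} f g = begin
    f ⊗ g                      ≈⟨ ⊗-cong (⨾-identityʳ f) (⨾-identityˡ g) ⟨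
    (f ⨾ id n) ⊗ (id p ⨾ g)    ≈⟨ ⊗-interchange f (id n) (id p) g ⟩
    (f ⊗ id p) ⨾ (id n ⊗ g)    ∎

  ⊗-as-⨾′ : ∀ {k m n p q} (f : Term G k m n) (g : Term G k p q) →
            f ⊗ g ≈ (id m ⊗ g) ⨾ (f ⊗ id q)
  ⊗-as-⨾′ {m = m} {q = q} f g = begin
    f ⊗ g                      ≈⟨ ⊗-cong (⨾-identityˡ f) (⨾-identityʳ g) ⟨
    (id m ⨾ f) ⊗ (g ⨾ id q)    ≈⟨ ⊗-interchange (id m) f g (id q) ⟩
    (id m ⊗ g) ⨾ (f ⊗ id q)    ∎

  ⊗-swap : ∀ {k m n p q} (f : Term G k m n) (g : Term G k p q) →
           f ⊗ g ≈ σ m p ⨾ (g ⊗ f) ⨾ σ q n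
  ⊗-swap {m = m} {n} {p} {q} f g = begin
    f ⊗ g                      ≈⟨ ⨾-identityʳ _ ⟨
    (f ⊗ g) ⨾ id (n + q)       ≈⟨ ⨾-congˡ (σ-involutive n q) ⟨
    (f ⊗ g) ⨾ σ n q ⨾ σ q n    ≈⟨ ⨾-assoc _ _ _ ⟨
    ((f ⊗ g) ⨾ σ n q) ⨾ σ q n  ≈⟨ ⨾-congʳ (σ-natural f g) ⟩
    (σ m p ⨾ (g ⊗ f)) ⨾ σ q n  ≈⟨ ⨾-assoc _ _ _ ⟩
    σ m p ⨾ (g ⊗ f) ⨾ σ q n    ∎

  ⊗-assoc⁻¹ : ∀ {k m m′ n n′ p p′}
              (f : Term G k m m′) (g : Term G k n n′) (h : Term G k p p′) →
              cast (sym (+-assoc m n p)) (sym (+-assoc m′ n′ p′)) (f ⊗ (g ⊗ h)) ≈ (f ⊗ g) ⊗ h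
  ⊗-assoc⁻¹ {m = m} {m′} {n} {n′} {p} {p′} f g h =
    cast-sym (+-assoc m n p) (+-assoc m′ n′ p′) (⊗-assoc f g h)

  Tr-tighteningʳ : ∀ {x m n o} (f : Term G traced (x + m) (x + n)) (h : Term G traced n o) →
                   Tr x (f ⨾ (id x ⊗ h)) ≈ Tr x f ⨾ h
  Tr-tighteningʳ {x} {m} f h = begin
    Tr x (f ⨾ (id x ⊗ h))                    ≈⟨ Tr-cong (⨾-identityˡ _) ⟨
    Tr x (id (x + m) ⨾ f ⨾ (id x ⊗ h))       ≈⟨ Tr-cong (⨾-congʳ (⊗-id x m)) ⟨
    Tr x ((id x ⊗ id m) ⨾ f ⨾ (id x ⊗ h))    ≈⟨ Tr-tightening (id m) f h ⟩
    id m ⨾ Tr x f ⨾ h                        ≈⟨ ⨾-identityˡ _ ⟩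
    Tr x f ⨾ h                               ∎

  Tr-tighteningˡ : ∀ {x l m n} (g : Term G traced l m) (f : Term G traced (x + m) (x + n)) →
                   Tr x ((id x ⊗ g) ⨾ f) ≈ g ⨾ Tr x f
  Tr-tighteningˡ {x} {n = n} g f = begin
    Tr x ((id x ⊗ g) ⨾ f)                    ≈⟨ Tr-cong (⨾-congˡ (⨾-identityʳ _)) ⟨
    Tr x ((id x ⊗ g) ⨾ f ⨾ id (x + n))       ≈⟨ Tr-cong (⨾-congˡ (⨾-congˡ (⊗-id x n))) ⟨
    Tr x ((id x ⊗ g) ⨾ f ⨾ (id x ⊗ id n))    ≈⟨ Tr-tightening g f (id n) ⟩
    g ⨾ Tr x f ⨾ id n                        ≈⟨ ⨾-congˡ (⨾-identityʳ _) ⟩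
    g ⨾ Tr x f                               ∎

  loop-generator : ∀ {a b} (f : Term G traced a b) → f ≈ Tr a ((f ⊗ id a) ⨾ σ b a)
  loop-generator {a} {b} f = begin
    f                             ≈⟨ ⨾-identityʳ f ⟨
    f ⨾ id b                      ≈⟨ ⨾-congˡ (Tr-yanking b) ⟨
    f ⨾ Tr b (σ b b)              ≈⟨ Tr-tighteningˡ f (σ b b) ⟨
    Tr b ((id b ⊗ f) ⨾ σ b b)     ≈⟨ Tr-cong (σ-natural (id b) f) ⟩
    Tr b (σ b a ⨾ (f ⊗ id b))     ≈⟨ Tr-sliding (σ b a) f ⟩
    Tr a ((f ⊗ id a) ⨾ σ b a)     ∎

  -- Tightening draws the second trace into the first. Superposing only adds wires on the right of a
  -- trace, so the symmetry first moves `Tr a′ g` to the left of `id a`; tightening then absorbs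
  -- everything into the trace over `a′`, and vanishing merges the two nested traces.
  Tr-⨾-Tr : ∀ {a a′ m n p} (f : Term G traced (a + m) (a + n)) (g : Term G traced (a′ + n) (a′ + p)) →
    Tr a f ⨾ Tr a′ g ≈
    Tr (a′ + a) (cast (sym (+-assoc a′ a m)) (sym (+-assoc a′ a p))
      ((id a′ ⊗ (f ⨾ σ a n)) ⨾ cast (+-assoc a′ n a) (+-assoc a′ p a) (g ⊗ id a) ⨾ (id a′ ⊗ σ p a)))
  Tr-⨾-Tr {a} {a′} {m} {n} {p} f g = begin
    Tr a f ⨾ Tr a′ g                                   ≈⟨ Tr-tighteningʳ f (Tr a′ g) ⟨
    Tr a (f ⨾ (id a ⊗ Tr a′ g))                        ≈⟨ Tr-cong (⨾-congˡ (⊗-swap (id a) (Tr a′ g))) ⟩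
    Tr a (f ⨾ σ a n ⨾ (Tr a′ g ⊗ id a) ⨾ σ p a)        ≈⟨ Tr-cong (⨾-assoc _ _ _) ⟨
    Tr a ((f ⨾ σ a n) ⨾ (Tr a′ g ⊗ id a) ⨾ σ p a)      ≈⟨ Tr-cong (⨾-congˡ (⨾-congʳ (Tr-superposing g (id a)))) ⟨
    Tr a ((f ⨾ σ a n) ⨾ Tr a′ g⊗id ⨾ σ p a)            ≈⟨ Tr-cong (Tr-tightening _ _ _) ⟨
    Tr a (Tr a′ ((id a′ ⊗ (f ⨾ σ a n)) ⨾ g⊗id ⨾ (id a′ ⊗ σ p a))) ≈⟨ Tr-vanishing₊ _ ⟨
    _ ∎
    where g⊗id = cast (+-assoc a′ n a) (+-assoc a′ p a) (g ⊗ id a)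

  middle-assoc : ∀ m n p q → m + ((n + p) + q) ≡ (m + n) + (p + q)
  middle-assoc m n p q = trans (cong (m +_) (+-assoc n p q)) (sym (+-assoc m n (p + q)))

  ⊗-middle-assoc : ∀ {k m m′ n n′ p p′ q q′}
    (f : Term G k m m′) (g : Term G k n n′) (h : Term G k p p′) (i : Term G k q q′) →
    cast (middle-assoc m n p q) (middle-assoc m′ n′ p′ q′) (f ⊗ ((g ⊗ h) ⊗ i)) ≈
    (f ⊗ g) ⊗ (h ⊗ i)
  ⊗-middle-assoc {m = m} {m′} {n} {n′} {p} {p′} {q} {q′} f g h i = begin
    cast (middle-assoc m n p q) (middle-assoc m′ n′ p′ q′) (f ⊗ ((g ⊗ h) ⊗ i))
      ≡⟨ cast-cast (cong (m +_) e) (sym _) (cong (m′ +_) e′) (sym _) _ ⟨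
    cast (sym (+-assoc m n _)) (sym (+-assoc m′ n′ _))
      (cast (cong (m +_) e) (cong (m′ +_) e′) (f ⊗ ((g ⊗ h) ⊗ i)))
      ≡⟨ cong (cast _ _) (cast-⊗ʳ e e′ f _) ⟩
    cast (sym (+-assoc m n _)) (sym (+-assoc m′ n′ _)) (f ⊗ cast e e′ ((g ⊗ h) ⊗ i))
      ≈⟨ cast-cong _ _ (⊗-congˡ (⊗-assoc g h i)) ⟩
    cast (sym (+-assoc m n _)) (sym (+-assoc m′ n′ _)) (f ⊗ (g ⊗ (h ⊗ i)))
      ≈⟨ ⊗-assoc⁻¹ f g (h ⊗ i) ⟩
    (f ⊗ g) ⊗ (h ⊗ i) ∎
    where
    e  = +-assoc n p q
    e′ = +-assoc n′ p′ q′

  middle-σ : ∀ {k} m n p q → Term G k ((m + n) + (p + q)) ((m + p) + (n + q))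
  middle-σ m n p q = cast (middle-assoc m n p q) (middle-assoc m p n q) (id m ⊗ (σ n p ⊗ id q))

  -- Rebracketing isolates the two inner factors, which `⊗-swap` conjugates by symmetries. Padding
  -- the outer factors with identities lets interchange split the whole into three layers.
  ⊗-middle-four : ∀ {k m m′ n n′ p p′ q q′}
    (f : Term G k m m′) (g : Term G k n n′) (h : Term G k p p′) (i : Term G k q q′) →
    (f ⊗ g) ⊗ (h ⊗ i) ≈ middle-σ m n p q ⨾ ((f ⊗ h) ⊗ (g ⊗ i)) ⨾ middle-σ m′ p′ n′ q′
  ⊗-middle-four {m = m} {m′} {n} {n′} {p} {p′} {q} {q′} f g h i = begin
    (f ⊗ g) ⊗ (h ⊗ i)
      ≈⟨ ⊗-middle-assoc f g h i ⟨
    cast e e′ (f ⊗ ((g ⊗ h) ⊗ i))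
      ≈⟨ cast-cong e e′ inner ⟩
    cast e e′ ((id m ⊗ (σ n p ⊗ id q)) ⨾ (f ⊗ ((h ⊗ g) ⊗ i)) ⨾ (id m′ ⊗ (σ p′ n′ ⊗ id q′)))
      ≡⟨ cast-⨾ e (middle-assoc m p n q) e′ _ _ ⟩
    middle-σ m n p q ⨾ cast _ e′ ((f ⊗ ((h ⊗ g) ⊗ i)) ⨾ (id m′ ⊗ (σ p′ n′ ⊗ id q′)))
      ≡⟨ cong (middle-σ m n p q ⨾_) (cast-⨾ _ (middle-assoc m′ p′ n′ q′) e′ _ _) ⟩
    middle-σ m n p q ⨾ cast _ _ (f ⊗ ((h ⊗ g) ⊗ i)) ⨾ middle-σ m′ p′ n′ q′
      ≈⟨ ⨾-congˡ (⨾-congʳ (⊗-middle-assoc f h g i)) ⟩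
    middle-σ m n p q ⨾ ((f ⊗ h) ⊗ (g ⊗ i)) ⨾ middle-σ m′ p′ n′ q′ ∎
    where
    e  = middle-assoc m n p q
    e′ = middle-assoc m′ n′ p′ q′
    inner : f ⊗ ((g ⊗ h) ⊗ i) ≈
            (id m ⊗ (σ n p ⊗ id q)) ⨾ (f ⊗ ((h ⊗ g) ⊗ i)) ⨾ (id m′ ⊗ (σ p′ n′ ⊗ id q′))
    inner = begin
      f ⊗ ((g ⊗ h) ⊗ i)
        ≈⟨ ⊗-congˡ (⊗-cong (⊗-swap g h) (≈-sym (⨾-identity _))) ⟩
      f ⊗ ((σ n p ⨾ (h ⊗ g) ⨾ σ p′ n′) ⊗ (id q ⨾ i ⨾ id q′))
        ≈⟨ ⊗-congˡ (⊗-interchange₃ _ _ _ _ _ _) ⟩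
      f ⊗ ((σ n p ⊗ id q) ⨾ ((h ⊗ g) ⊗ i) ⨾ (σ p′ n′ ⊗ id q′))
        ≈⟨ ⊗-congʳ (≈-sym (⨾-identity _)) ⟩
      (id m ⨾ f ⨾ id m′) ⊗ ((σ n p ⊗ id q) ⨾ ((h ⊗ g) ⊗ i) ⨾ (σ p′ n′ ⊗ id q′))
        ≈⟨ ⊗-interchange₃ _ _ _ _ _ _ ⟩
      _ ∎

-- Combinational circuits among the sequential ones.

module NormalForm (S : Signature) where
  open Signature S
  open Circuits S

  -- Calculations with traces take place in `SCirc`; the plain preimage carried along here is what
  -- the rewrite rules ask for in the end.
  Combinational : ∀ {m n} → SCirc m n → Set
  Combinational {m} {n} f = Σ[ c ∈ CCirc m n ] ⌜ c ⌝ ≡ f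

  comb-id : ∀ {n} → Combinational (id n)
  comb-id = id _ , refl

  comb-σ : ∀ m n → Combinational (σ m n)
  comb-σ m n = σ m n , refl

  comb-⨾ : ∀ {l m n} {f : SCirc l m} {g : SCirc m n} →
           Combinational f → Combinational g → Combinational (f ⨾ g)
  comb-⨾ (c , refl) (d , refl) = c ⨾ d , refl

  comb-⊗ : ∀ {m n p q} {f : SCirc m n} {g : SCirc p q} →
           Combinational f → Combinational g → Combinational (f ⊗ g)
  comb-⊗ (c , refl) (d , refl) = c ⊗ d , refl

  comb-cast : ∀ {m m′ n n′} (p : m ≡ m′) (q : n ≡ n′) {f : SCirc m n} →
              Combinational f → Combinational (cast p q f)
  comb-cast refl refl c = c

  comb-middle-σ : ∀ m n p q → Combinational (middle-σ m n p q)
  comb-middle-σ m n p q =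
    comb-cast _ _ (comb-⊗ comb-id (comb-⊗ (comb-σ n p) comb-id))

  -- Parallel composites of wires, delays and values.

  delays-+ : ∀ y y′ → delays y ⊗ delays y′ ≈ delays (y + y′)
  delays-+ zero    y′ = ⊗-identityˡ _
  delays-+ (suc y) y′ = begin
    (gen delay ⊗ delays y) ⊗ delays y′
      ≡⟨ cast-loop (+-assoc 1 y y′) (+-assoc 1 y y′) _ ⟨
    cast (+-assoc 1 y y′) (+-assoc 1 y y′) ((gen delay ⊗ delays y) ⊗ delays y′)
      ≈⟨ ⊗-assoc _ _ _ ⟩
    gen delay ⊗ (delays y ⊗ delays y′)
      ≈⟨ ⊗-congˡ (delays-+ y y′) ⟩
    gen delay ⊗ delays (y + y′) ∎

  vals-++ : ∀ {z z′} (v : Vec V z) (v′ : Vec V z′) → vals v ⊗ vals v′ ≈ vals (v ++ v′)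
  vals-++ []                   v′ = ⊗-identityˡ _
  vals-++ {suc z} {z′} (w ∷ v) v′ = begin
    (val w ⊗ vals v) ⊗ vals v′
      -- The domains are all 0, where `+-assoc 0 0 0` computes to `refl`.
      ≡⟨ cast-loop refl (+-assoc 1 z z′) _ ⟨
    cast (+-assoc 0 0 0) (+-assoc 1 z z′) ((val w ⊗ vals v) ⊗ vals v′)
      ≈⟨ ⊗-assoc _ _ _ ⟩
    val w ⊗ (vals v ⊗ vals v′)
      ≈⟨ ⊗-congˡ (vals-++ v v′) ⟩
    val w ⊗ vals (v ++ v′) ∎

  -- The summand 0 in the domain is the empty domain of the values. It is kept to avoid a transport
  -- in every lemma and is removed only on passing to trace-delay form.
  sources : ∀ x y {z} → Vec V z → SCirc ((x + y) + 0) ((x + y) + z)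
  sources x y v = (id x ⊗ delays y) ⊗ vals v

  -- Arbitrary combinational circuits are allowed on both sides, not just permutations, because both
  -- are later absorbed into the combinational body of a trace.
  record Sorted {a b} (f : SCirc a b) : Set where
    constructor sorted
    field
      x y      : ℕ
      {z}      : ℕ
      v        : Vec V z
      {before} : SCirc a ((x + y) + 0)
      {after}  : SCirc ((x + y) + z) b
      before-comb : Combinational before
      after-comb  : Combinational after
      equation : f ≈ before ⨾ sources x y v ⨾ after

  sources-sorted : ∀ x y {z} (v : Vec V z) → Sorted (sources x y v)
  sources-sorted x y v = sorted x y v comb-id comb-id
    (≈-sym (⨾-identity _))

  sorted-cast : ∀ {a a′ b b′} (p : a ≡ a′) (q : b ≡ b′) {f : SCirc a b} →
                Sorted f → Sorted (cast p q f)
  sorted-cast refl refl s = s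

  sorted-resp-≈ : ∀ {a b} {f g : SCirc a b} → f ≈ g → Sorted f → Sorted g
  sorted-resp-≈ f≈g (sorted x y v c d e) = sorted x y v c d (≈-trans (≈-sym f≈g) e)

  sorted-⨾ : ∀ {a b c d} {p : SCirc a b} {f : SCirc b c} {q : SCirc c d} →
             Combinational p → Sorted f → Combinational q → Sorted (p ⨾ f ⨾ q)
  sorted-⨾ {p = p} {f} {q} cp (sorted x y v {before} {after} cb ca f≈) cq =
    sorted x y v (comb-⨾ cp cb) (comb-⨾ ca cq) (begin
      p ⨾ f ⨾ q                                     ≈⟨ ⨾-congˡ (⨾-congʳ f≈) ⟩
      p ⨾ (before ⨾ sources x y v ⨾ after) ⨾ q      ≈⟨ ⨾-congˡ (⨾-assoc _ _ _) ⟩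
      p ⨾ before ⨾ (sources x y v ⨾ after) ⨾ q      ≈⟨ ⨾-congˡ (⨾-congˡ (⨾-assoc _ _ _)) ⟩
      p ⨾ before ⨾ sources x y v ⨾ after ⨾ q        ≈⟨ ⨾-assoc _ _ _ ⟨
      (p ⨾ before) ⨾ sources x y v ⨾ after ⨾ q      ∎)

  sorted-id : ∀ x → Sorted (id x)
  sorted-id x = sorted-resp-≈ cast-sources≈id (sorted-cast e e (sources-sorted x 0 []))
    where
    e = trans (+-identityʳ (x + 0)) (+-identityʳ x)
    cast-sources≈id : cast e e (sources x 0 []) ≈ id x
    cast-sources≈id = begin
      cast e e ((id x ⊗ id 0) ⊗ id 0)   ≈⟨ cast-cong e e (⊗-congʳ (⊗-id x 0)) ⟩
      cast e e (id (x + 0) ⊗ id 0)      ≈⟨ cast-cong e e (⊗-id (x + 0) 0) ⟩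
      cast e e (id (x + 0 + 0))         ≡⟨ cast-id {SGen} e e ⟩
      id x                              ∎

  sorted-delay : Sorted (gen delay)
  sorted-delay = sorted-resp-≈
    (≈-trans (⊗-identityʳ _) (≈-trans (⊗-identityˡ _) (⊗-identityʳ (gen delay))))
    (sources-sorted 0 1 [])

  sorted-val : ∀ v → Sorted (val v)
  sorted-val v = sorted-resp-≈
    (≈-trans (⊗-cong (⊗-id 0 0) (⊗-identityʳ (val v))) (⊗-identityˡ (val v)))
    (sources-sorted 0 0 (v ∷ []))

  -- Two middle-four exchanges: the first, in the proof term, separates the values from the wires
  -- and delays, and the second, `shuffle`, separates the wires from the delays. Like blocks are
  -- then adjacent and `merge` fuses them.
  sorted-sources-⊗ : ∀ x y {z} (v : Vec V z) x′ y′ {z′} (v′ : Vec V z′) →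
                     Sorted (sources x y v ⊗ sources x′ y′ v′)
  sorted-sources-⊗ x y {z} v x′ y′ {z′} v′ =
    sorted-resp-≈ (≈-sym (⊗-middle-four (id x ⊗ delays y) (vals v) (id x′ ⊗ delays y′) (vals v′)))
      (sorted-⨾ (comb-middle-σ (x + y) 0 (x′ + y′) 0)
        (sorted-resp-≈ (≈-sym shuffle)
          (sorted-⨾ (comb-⊗ (comb-middle-σ x y x′ y′) comb-id)
            (sorted-resp-≈ merge (sources-sorted (x + x′) (y + y′) (v ++ v′)))
            (comb-⊗ (comb-middle-σ x x′ y y′) comb-id)))
        (comb-middle-σ (x + y) (x′ + y′) z z′))
    where
    merge : sources (x + x′) (y + y′) (v ++ v′) ≈
            ((id x ⊗ id x′) ⊗ (delays y ⊗ delays y′)) ⊗ (vals v ⊗ vals v′)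
    merge = ≈-sym (⊗-cong (⊗-cong (⊗-id x x′) (delays-+ y y′)) (vals-++ v v′))
    shuffle : ((id x ⊗ delays y) ⊗ (id x′ ⊗ delays y′)) ⊗ (vals v ⊗ vals v′) ≈
              (middle-σ x y x′ y′ ⊗ id 0) ⨾
              (((id x ⊗ id x′) ⊗ (delays y ⊗ delays y′)) ⊗ (vals v ⊗ vals v′)) ⨾
              (middle-σ x x′ y y′ ⊗ id (z + z′))
    shuffle = ≈-trans
      (⊗-cong (⊗-middle-four (id x) (delays y) (id x′) (delays y′)) (≈-sym (⨾-identity _)))
      (⊗-interchange₃ _ _ _ _ _ _)

  sorted-⊗ : ∀ {a b a′ b′} {f : SCirc a b} {g : SCirc a′ b′} →
             Sorted f → Sorted g → Sorted (f ⊗ g)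
  sorted-⊗ (sorted x y v cb ca f≈) (sorted x′ y′ v′ cb′ ca′ g≈) =
    sorted-resp-≈ (≈-sym (≈-trans (⊗-cong f≈ g≈) (⊗-interchange₃ _ _ _ _ _ _)))
      (sorted-⨾ (comb-⊗ cb cb′) (sorted-sources-⊗ x y v x′ y′ v′) (comb-⊗ ca ca′))

  -- Circuits as one trace around a sorted circuit and a combinational body.

  record Looped {m n} (f : SCirc m n) : Set where
    constructor looped
    field
      {a b}         : ℕ
      {loop}        : SCirc a b
      {body}        : SCirc (b + m) (a + n)
      loop-sorted   : Sorted loop
      body-comb     : Combinational body
      equation      : f ≈ Tr a ((loop ⊗ id m) ⨾ body)

  looped-resp-≈ : ∀ {m n} {f g : SCirc m n} → f ≈ g → Looped f → Looped g
  looped-resp-≈ f≈g (looped s c e) = looped s c (≈-trans (≈-sym f≈g) e)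

  looped-comb : ∀ {m n} {f : SCirc m n} → Combinational f → Looped f
  looped-comb {m} {f = f} c = looped (sorted-id 0) c (begin
    f                           ≈⟨ ⨾-identityˡ f ⟨
    id m ⨾ f                    ≈⟨ ⨾-congʳ (⊗-identityˡ (id m)) ⟨
    (id 0 ⊗ id m) ⨾ f           ≈⟨ Tr-vanishing₀ _ ⟨
    Tr 0 ((id 0 ⊗ id m) ⨾ f)    ∎)

  looped-sorted : ∀ {m n} {f : SCirc m n} → Sorted f → Looped f
  looped-sorted {m} {n} {f} s = looped s (comb-σ n m) (loop-generator f)

  -- The loop of the second circuit stands first because `Tr-⨾-Tr` nests the trace over `a′` inside
  -- the one over `a`. The first body leaves the wires `a′` alone, so interchange moves `u′` in
  -- front of it and both loops form a single block.
  looped-⨾ : ∀ {m n p} {f : SCirc m n} {g : SCirc n p} → Looped f → Looped g → Looped (f ⨾ g)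
  looped-⨾ {m} {n} {p} {f} {g}
    (looped {a} {b} {u} {F} su cF f≈) (looped {a′} {b′} {u′} {F′} su′ cF′ g≈) =
    looped (sorted-⊗ su′ su)
      (comb-cast _ _ (comb-⨾ (comb-⊗ comb-id (comb-⨾ cF (comb-σ a n)))
        (comb-⨾ (comb-cast _ _ (comb-⊗ cF′ comb-id)) (comb-⊗ comb-id (comb-σ p a)))))
      (begin
        f ⨾ g
          ≈⟨ ⨾-cong f≈ g≈ ⟩
        Tr a ((u ⊗ id m) ⨾ F) ⨾ Tr a′ ((u′ ⊗ id n) ⨾ F′)
          ≈⟨ Tr-⨾-Tr _ _ ⟩
        Tr (a′ + a) (cast α γ ((id a′ ⊗ (((u ⊗ id m) ⨾ F) ⨾ σ a n)) ⨾
          cast δ ε (((u′ ⊗ id n) ⨾ F′) ⊗ id a) ⨾ (id a′ ⊗ σ p a)))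
          ≈⟨ Tr-cong (cast-cong α γ inner) ⟩
        Tr (a′ + a) (cast α γ ((u′ ⊗ (u ⊗ id m)) ⨾ rest))
          ≡⟨ cong (Tr (a′ + a)) (cast-⨾ α β γ _ _) ⟩
        Tr (a′ + a) (cast α β (u′ ⊗ (u ⊗ id m)) ⨾ cast β γ rest)
          ≈⟨ Tr-cong (⨾-congʳ (⊗-assoc⁻¹ u′ u (id m))) ⟩
        Tr (a′ + a) (((u′ ⊗ u) ⊗ id m) ⨾ cast β γ rest) ∎)
    where
    α = sym (+-assoc a′ a m)
    β = sym (+-assoc b′ b m)
    γ = sym (+-assoc a′ a p)
    δ = +-assoc a′ n a
    δ′ = +-assoc b′ n a
    ε = +-assoc a′ p a
    F⁺ : SCirc (b′ + (n + a)) (a′ + (p + a))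
    F⁺ = cast δ′ ε (F′ ⊗ id a)
    rest : SCirc (b′ + (b + m)) (a′ + (a + p))
    rest = (id b′ ⊗ (F ⨾ σ a n)) ⨾ F⁺ ⨾ (id a′ ⊗ σ p a)
    second : cast δ ε (((u′ ⊗ id n) ⨾ F′) ⊗ id a) ≈ (u′ ⊗ id (n + a)) ⨾ F⁺
    second = begin
      cast δ ε (((u′ ⊗ id n) ⨾ F′) ⊗ id a)               ≈⟨ cast-cong δ ε (⊗-distribʳ-⨾ a _ _) ⟩
      cast δ ε (((u′ ⊗ id n) ⊗ id a) ⨾ (F′ ⊗ id a))      ≡⟨ cast-⨾ δ δ′ ε _ _ ⟩
      cast δ δ′ ((u′ ⊗ id n) ⊗ id a) ⨾ F⁺                ≈⟨ ⨾-congʳ (⊗-assoc u′ (id n) (id a)) ⟩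
      (u′ ⊗ (id n ⊗ id a)) ⨾ F⁺                          ≈⟨ ⨾-congʳ (⊗-congˡ (⊗-id n a)) ⟩
      (u′ ⊗ id (n + a)) ⨾ F⁺                             ∎
    inner : (id a′ ⊗ (((u ⊗ id m) ⨾ F) ⨾ σ a n)) ⨾
            cast δ ε (((u′ ⊗ id n) ⨾ F′) ⊗ id a) ⨾ (id a′ ⊗ σ p a) ≈
            (u′ ⊗ (u ⊗ id m)) ⨾ rest
    inner = begin
      (id a′ ⊗ (((u ⊗ id m) ⨾ F) ⨾ σ a n)) ⨾ cast δ ε (((u′ ⊗ id n) ⨾ F′) ⊗ id a) ⨾ τ
        ≈⟨ ⨾-cong (⊗-congˡ (⨾-assoc _ _ _)) (⨾-congʳ second) ⟩
      (id a′ ⊗ ((u ⊗ id m) ⨾ F ⨾ σ a n)) ⨾ ((u′ ⊗ id (n + a)) ⨾ F⁺) ⨾ τ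
        ≈⟨ ⨾-congˡ (⨾-assoc _ _ _) ⟩
      (id a′ ⊗ ((u ⊗ id m) ⨾ F ⨾ σ a n)) ⨾ (u′ ⊗ id (n + a)) ⨾ F⁺ ⨾ τ
        ≈⟨ ⨾-assoc _ _ _ ⟨
      ((id a′ ⊗ ((u ⊗ id m) ⨾ F ⨾ σ a n)) ⨾ (u′ ⊗ id (n + a))) ⨾ F⁺ ⨾ τ
        ≈⟨ ⨾-congʳ (⊗-as-⨾′ u′ _) ⟨
      (u′ ⊗ ((u ⊗ id m) ⨾ F ⨾ σ a n)) ⨾ F⁺ ⨾ τ
        -- The added identity gives both factors two stages, so that interchange can put the two
        -- loops into the first.
        ≈⟨ ⨾-congʳ (⊗-congʳ (⨾-identityʳ u′)) ⟨
      ((u′ ⨾ id b′) ⊗ ((u ⊗ id m) ⨾ F ⨾ σ a n)) ⨾ F⁺ ⨾ τ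
        ≈⟨ ⨾-congʳ (⊗-interchange _ _ _ _) ⟩
      ((u′ ⊗ (u ⊗ id m)) ⨾ (id b′ ⊗ (F ⨾ σ a n))) ⨾ F⁺ ⨾ τ
        ≈⟨ ⨾-assoc _ _ _ ⟩
      (u′ ⊗ (u ⊗ id m)) ⨾ rest ∎
      where τ = id a′ ⊗ σ p a

  looped-⊗id : ∀ {m n} p {f : SCirc m n} → Looped f → Looped (f ⊗ id p)
  looped-⊗id {m} {n} p {f} (looped {a} {b} {u} {F} su cF f≈) =
    looped su (comb-cast (+-assoc b m p) ε (comb-⊗ cF comb-id)) (begin
      f ⊗ id p
        ≈⟨ ⊗-congʳ f≈ ⟩
      Tr a ((u ⊗ id m) ⨾ F) ⊗ id p
        ≈⟨ Tr-superposing _ _ ⟨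
      Tr a (cast α ε (((u ⊗ id m) ⨾ F) ⊗ id p))
        ≈⟨ Tr-cong (cast-cong α ε (⊗-distribʳ-⨾ p _ _)) ⟩
      Tr a (cast α ε (((u ⊗ id m) ⊗ id p) ⨾ (F ⊗ id p)))
        ≡⟨ cong (Tr a) (cast-⨾ α β ε _ _) ⟩
      Tr a (cast α β ((u ⊗ id m) ⊗ id p) ⨾ cast β ε (F ⊗ id p))
        ≈⟨ Tr-cong (⨾-congʳ (⊗-assoc u (id m) (id p))) ⟩
      Tr a ((u ⊗ (id m ⊗ id p)) ⨾ cast β ε (F ⊗ id p))
        ≈⟨ Tr-cong (⨾-congʳ (⊗-congˡ (⊗-id m p))) ⟩
      Tr a ((u ⊗ id (m + p)) ⨾ cast β ε (F ⊗ id p)) ∎)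
    where
    α = +-assoc a m p
    β = +-assoc b m p
    ε = +-assoc a n p

  -- A tensor is a composite of two circuits each padded with identities. Superposing handles
  -- padding on the right; padding on the left is reduced to it by conjugating with symmetries.
  looped-⊗ : ∀ {m n p q} {f : SCirc m n} {g : SCirc p q} → Looped f → Looped g → Looped (f ⊗ g)
  looped-⊗ {n = n} {p} {q} {f} {g} lf lg = looped-resp-≈ (≈-sym (⊗-as-⨾ f g))
    (looped-⨾ (looped-⊗id p lf)
      (looped-resp-≈ (≈-sym (⊗-swap (id n) g))
        (looped-⨾ (looped-comb (comb-σ n p))
          (looped-⨾ (looped-⊗id n lg) (looped-comb (comb-σ q n))))))

  -- The wires fed back by the new trace join the loop as an identity block. In `normalise` this is
  -- the only origin of undelayed feedback wires, the ones that the rule `IF` later removes.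
  looped-Tr : ∀ x {m n} {f : SCirc (x + m) (x + n)} → Looped f → Looped (Tr x f)
  looped-Tr x {m} {n} {f} (looped {a} {b} {u} {F} su cF f≈) =
    looped (sorted-⊗ su (sorted-id x)) (comb-cast β γ cF) (begin
      Tr x f
        ≈⟨ Tr-cong f≈ ⟩
      Tr x (Tr a ((u ⊗ id (x + m)) ⨾ F))
        ≈⟨ Tr-vanishing₊ _ ⟨
      Tr (a + x) (cast α γ ((u ⊗ id (x + m)) ⨾ F))
        ≡⟨ cong (Tr (a + x)) (cast-⨾ α β γ _ _) ⟩
      Tr (a + x) (cast α β (u ⊗ id (x + m)) ⨾ cast β γ F)
        ≈⟨ Tr-cong (⨾-congʳ (cast-cong α β (⊗-congˡ (⊗-id x m)))) ⟨
      Tr (a + x) (cast α β (u ⊗ (id x ⊗ id m)) ⨾ cast β γ F)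
        ≈⟨ Tr-cong (⨾-congʳ (⊗-assoc⁻¹ u (id x) (id m))) ⟩
      Tr (a + x) (((u ⊗ id x) ⊗ id m) ⨾ cast β γ F) ∎)
    where
    α = sym (+-assoc a x m)
    β = sym (+-assoc b x m)
    γ = sym (+-assoc a x n)

  val-value : ∀ v (v≢• : v ≢ •) → val v ≡ gen (value v v≢•)
  val-value v v≢• with v ≟ⱽ •
  ... | yes v≡• = contradiction v≡• v≢•
  -- The proof found by the decision and the given one are definitionally equal, as functions into
  -- the empty type.
  ... | no  _   = refl

  normalise : ∀ {m n} (f : SCirc m n) → Looped f
  normalise (gen (comb g))      = looped-comb (gen g , refl)
  normalise (gen (value v v≢•)) = looped-sorted (subst Sorted (val-value v v≢•) (sorted-val v))
  normalise (gen delay)         = looped-sorted sorted-delay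
  normalise (id n)              = looped-comb comb-id
  normalise (f ⨾ g)             = looped-⨾ (normalise f) (normalise g)
  normalise (f ⊗ g)             = looped-⊗ (normalise f) (normalise g)
  normalise (σ m n)             = looped-comb (comb-σ m n)
  normalise (Tr x f)            = looped-Tr x (normalise f)

  -- Global trace-delay form.

  traceDelayForm : ∀ {m n} x y {z} → Vec V z → CCirc ((x + y) + (z + m)) ((x + y) + n) → SCirc m n
  traceDelayForm {m} x y v f̂ =
    Tr (x + y) (((id x ⊗ delays y) ⊗ (vals v ⊗ id m)) ⨾ ⌜ f̂ ⌝)

  toTraceDelayForm : ∀ {m n} (f : SCirc m n) →
    Σ[ x ∈ ℕ ] Σ[ y ∈ ℕ ] Σ[ z ∈ ℕ ] Σ[ v ∈ Vec V z ]
    Σ[ f̂ ∈ CCirc ((x + y) + (z + m)) ((x + y) + n) ] f ≈ traceDelayForm x y v f̂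
  toTraceDelayForm {m} {n} f with normalise f
  ... | looped {a} {b} {u} {F} (sorted x y {z} v {before} {after} cb ca u≈) cF f≈ =
    let body , body≡ = comb-cast β γ (comb-⨾ (comb-⊗ ca comb-id) (comb-⨾ cF (comb-⊗ cb comb-id)))
    in x , y , z , v , body , (begin
      f
        ≈⟨ f≈ ⟩
      Tr a ((u ⊗ id m) ⨾ F)
        ≈⟨ Tr-cong (⨾-congʳ (⊗-cong u≈ (≈-sym (⨾-identity (id m))))) ⟩
      Tr a (((before ⨾ sources x y v ⨾ after) ⊗ (id m ⨾ id m ⨾ id m)) ⨾ F)
        ≈⟨ Tr-cong (⨾-congʳ (⊗-interchange₃ _ _ _ _ _ _)) ⟩
      Tr a (((before ⊗ id m) ⨾ (sources x y v ⊗ id m) ⨾ (after ⊗ id m)) ⨾ F)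
        ≈⟨ Tr-cong (≈-trans (⨾-assoc _ _ _) (⨾-congˡ (⨾-assoc _ _ _))) ⟩
      Tr a ((before ⊗ id m) ⨾ (sources x y v ⊗ id m) ⨾ (after ⊗ id m) ⨾ F)
        -- Sliding also changes the traced object from `a` to the domain of the sources.
        ≈⟨ Tr-sliding _ before ⟨
      Tr (x + y + 0) (((sources x y v ⊗ id m) ⨾ (after ⊗ id m) ⨾ F) ⨾ (before ⊗ id n))
        ≈⟨ Tr-cong (≈-trans (⨾-assoc _ _ _) (⨾-congˡ (⨾-assoc _ _ _))) ⟩
      Tr (x + y + 0) ((sources x y v ⊗ id m) ⨾ rest)
        ≡⟨ Tr-cast e _ ⟩
      Tr (x + y) (cast α γ ((sources x y v ⊗ id m) ⨾ rest))
        ≡⟨ cong (Tr (x + y)) (cast-⨾ α β γ _ _) ⟩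
      Tr (x + y) (cast α β (sources x y v ⊗ id m) ⨾ cast β γ rest)
        -- Both proofs equate the same two numbers, since `0 + m` reduces to `m`; exchanging them
        -- produces the transport that `⊗-assoc` expects.
        ≡⟨ cong (λ p → Tr (x + y) (cast p β (sources x y v ⊗ id m) ⨾ cast β γ rest)) (≡-irrelevant _ _) ⟩
      Tr (x + y) (cast (+-assoc (x + y) 0 m) β (sources x y v ⊗ id m) ⨾ cast β γ rest)
        ≈⟨ Tr-cong (⨾-congʳ (⊗-assoc (id x ⊗ delays y) (vals v) (id m))) ⟩
      Tr (x + y) (((id x ⊗ delays y) ⊗ (vals v ⊗ id m)) ⨾ cast β γ rest)
        ≡⟨ cong (λ h → Tr (x + y) (((id x ⊗ delays y) ⊗ (vals v ⊗ id m)) ⨾ h)) body≡ ⟨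
      traceDelayForm x y v body ∎)
    where
    e = +-identityʳ (x + y)
    α = cong (_+ m) e
    β = +-assoc (x + y) z m
    γ = cong (_+ n) e
    rest : SCirc (x + y + z + m) (x + y + 0 + n)
    rest = (after ⊗ id m) ⨾ F ⨾ (before ⊗ id n)

-- Longest chains in finite strict orders.

maximum : (P : ℕ → Set) → (∀ n → Dec (P n)) → P 0 → ∀ b → (∀ d → P d → d ≤ b) →
          Σ[ c ∈ ℕ ] (P c × (∀ d → P d → d ≤ c))
maximum P P? p₀ zero    bound = 0 , p₀ , bound
maximum P P? p₀ (suc b) bound with P? (suc b)
... | yes p = suc b , p , bound
-- Once `suc b` is excluded, `b` is itself a bound, and the search continues downwards until `P 0`
-- stops it.
... | no ¬p = maximum P P? p₀ b λ d pd →
      ≤-pred (≤∧≢⇒< (bound d pd) λ { refl → ¬p pd })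

module Chains {A : Set} {N : ℕ} (finite : A ↔ Fin N)
  {_<_ : Rel A 0ℓ} (_<?_ : Decidable _<_) (<-trans : Transitive _<_) (<-irrefl : Irreflexive _≡_ _<_)
  where

  ChainOf : ℕ → Set
  ChainOf c = ∃ λ (v : Fin (suc c) → A) → v Preserves _<ᶠ_ ⟶ _<_

  -- Chains as functions out of `Fin` are awkward to search for. This form chooses one successor at
  -- a time from the finite carrier and compares neighbours only, so it is decidable by recursion.
  Ascent : A → ℕ → Set
  Ascent a zero    = ⊤
  Ascent a (suc c) = ∃[ b ] (a < b × Ascent b c)

  ∃-dec : {P : A → Set} → (∀ a → Dec (P a)) → Dec (∃ P)
  ∃-dec {P} P? = map′ (λ (i , p) → from i , p) (λ (a , p) → to a , subst P (sym (strictlyInverseʳ a)) p)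
                      (any? (P? ∘ from))
    where open Inverse finite

  ascent? : ∀ c a → Dec (Ascent a c)
  ascent? zero    a = yes _
  ascent? (suc c) a = ∃-dec λ b → (a <? b) ×-dec ascent? c b

  -- The equation on the first entry identifies `b` with the head of the recursive chain, so that
  -- `a` can be put in front. Transitivity gives the comparisons of `a` with later entries.
  ascent⇒chain : ∀ c {a} → Ascent a c → Σ[ (v , _) ∈ ChainOf c ] v zero ≡ a
  ascent⇒chain zero    {a} _ = ((λ _ → a) , λ { {zero} {zero} () }) , refl
  ascent⇒chain (suc c) {a} (b , a<b , r) with ascent⇒chain c r
  ... | (v , mono) , refl = (v′ , mono′) , refl
    where
    v′ : Fin (suc (suc c)) → A
    v′ zero    = a
    v′ (suc i) = v i
    mono′ : v′ Preserves _<ᶠ_ ⟶ _<_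
    mono′ {zero}  {suc zero}    _         = a<b
    mono′ {zero}  {suc (suc j)} _         = <-trans a<b (mono (s≤s z≤n))
    mono′ {suc i} {suc j}       (s≤s i<j) = mono i<j

  chain⇒ascent : ∀ c ((v , _) : ChainOf c) → Ascent (v zero) c
  chain⇒ascent zero    _          = _
  chain⇒ascent (suc c) (v , mono) =
    v (suc zero) , mono (s≤s z≤n) , chain⇒ascent c (v ∘ suc , λ i<j → mono (s≤s i<j))

  chain? : ∀ c → Dec (ChainOf c)
  chain? c = map′ (λ (_ , r) → proj₁ (ascent⇒chain c r)) (λ ch → _ , chain⇒ascent c ch)
                  (∃-dec (ascent? c))

  -- A longer chain would repeat an entry by the pigeonhole principle, against irreflexivity. The
  -- bound is one more than the `suc c` distinct entries permit, but `maximum` accepts any bound.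
  chain-bound : ∀ c → ChainOf c → c ≤ N
  chain-bound c (v , mono) = ≮⇒≥ λ N<c →
    let i , j , i<j , eq = pigeonhole (m≤n⇒m≤1+n N<c) (to ∘ v)
    in <-irrefl (to-injective eq) (mono i<j)
    where
    open Inverse finite
    to-injective : ∀ {a b} → to a ≡ to b → a ≡ b
    to-injective {a} {b} eq =
      trans (sym (strictlyInverseʳ a)) (trans (cong from eq) (strictlyInverseʳ b))

  -- The given element makes the carrier inhabited, which yields a chain of length 0 to start from.
  longest : A → Σ[ c ∈ ℕ ] (ChainOf c × (∀ d → ChainOf d → d ≤ c))
  longest a = maximum ChainOf chain? ((λ _ → a) , λ { {zero} {zero} () }) N chain-bound

Vec-finite : ∀ {A : Set} {N} → A ↔ Fin N → ∀ n → Vec A n ↔ Fin (N ^ n)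
Vec-finite f zero    = mk↔ₛ′ (λ _ → zero) (λ _ → []) (λ { zero → refl }) (λ { [] → refl })
Vec-finite f (suc n) =
  ↔-sym *↔× ↔-∘ ((f ×-↔ Vec-finite f n) ↔-∘
  mk↔ₛ′ (λ { (a ∷ as) → a , as }) (uncurry _∷_) (λ _ → refl) (λ { (_ ∷ _) → refl }))

-- Chain lengths of value vectors and the splitting of a trace.

module _ (S : Signature) where
  open Signature S
  open Circuits S

  longestChainLength : (I : Interpretation) → ∀ n → ∃ (Interpretation.LongestChainLength I n)
  longestChainLength I n = longest (replicate n •)
    where
    open Interpretation I
    module L = IsLattice isLattice
    joinSemilattice : JoinSemilattice _ _ _
    joinSemilattice = record { isJoinSemilattice = L.isJoinSemilattice }
    pointwise-isPartialOrder : IsPartialOrder _≡_ (Pointwise _⊑_ {n} {n})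
    pointwise-isPartialOrder = record
      { isPreorder = record
        { isEquivalence = isEquivalence
        ; reflexive     = λ { refl → Pointwise.refl L.refl }
        ; trans         = Pointwise.trans L.trans
        }
      ; antisym = λ p q → antisym p q
      }
      where
      antisym : ∀ {n} {u v : Vec V n} →
                Pointwise _⊑_ u v → Pointwise _⊑_ v u → u ≡ v
      antisym Pointwise.[]       Pointwise.[]       = refl
      antisym (p Pointwise.∷ ps) (q Pointwise.∷ qs) = cong₂ _∷_ (L.antisym p q) (antisym ps qs)
    open Chains (Vec-finite (proj₂ V-finite) n)
      (ToStrict.<-decidable _≡_ (Pointwise _⊑_) (≡-dec _≟ⱽ_)
        -- The order on values is decided through the join: `u ⊑ v` holds exactly when `u ⊔ v`
        -- equals `v`, and equality of values is decidable.
        (Pointwise.decidable (≈-dec⇒≤-dec joinSemilattice _≟ⱽ_)))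
      (ToStrict.<-trans _≡_ (Pointwise _⊑_) pointwise-isPartialOrder)
      (ToStrict.<-irrefl _≡_ (Pointwise _⊑_))

  -- Vanishing makes the trace over `x` the inner one, and `r` does not touch the wires `x`, so
  -- tightening takes it out. The transport sits under the embedding so that the inner trace is
  -- literally a redex of `IF`.
  split-Tr : ∀ x {y m n} (r : SCirc y y) (h : CCirc ((x + y) + m) ((x + y) + n)) →
    Tr (x + y) (((id x ⊗ r) ⊗ id m) ⨾ ⌜ h ⌝) ≈
    Tr y ((r ⊗ id m) ⨾ Tr x ⌜ cast (+-assoc x y m) (+-assoc x y n) h ⌝)
  split-Tr x {y} {m} {n} r h = ≈-sym (begin
    Tr y ((r ⊗ id m) ⨾ Tr x ⌜ cast α β h ⌝)
      ≈⟨ Tr-cong (Tr-tighteningˡ _ _) ⟨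
    Tr y (Tr x ((id x ⊗ (r ⊗ id m)) ⨾ ⌜ cast α β h ⌝))
      ≈⟨ Tr-vanishing₊ _ ⟨
    Tr (x + y) (cast (sym α) (sym β) ((id x ⊗ (r ⊗ id m)) ⨾ ⌜ cast α β h ⌝))
      ≡⟨ cong (Tr (x + y)) (cast-⨾ (sym α) (sym α) (sym β) _ _) ⟩
    Tr (x + y) (cast (sym α) (sym α) (id x ⊗ (r ⊗ id m)) ⨾ cast (sym α) (sym β) ⌜ cast α β h ⌝)
      ≈⟨ Tr-cong (⨾-cong (⊗-assoc⁻¹ (id x) r (id m)) (≡⇒≈ (uncast α β h))) ⟩
    Tr (x + y) (((id x ⊗ r) ⊗ id m) ⨾ ⌜ h ⌝) ∎)
    where
    α = +-assoc x y m
    β = +-assoc x y n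
    uncast : ∀ {k k′ l l′} (p : k ≡ k′) (q : l ≡ l′) (h : CCirc k l) →
             cast (sym p) (sym q) ⌜ cast p q h ⌝ ≡ ⌜ h ⌝
    uncast refl refl h = refl

-- The two rewrites.

theorem5p24 : (S : Signature) →
    let open Signature S
        open Circuits S
    in
    (I : Interpretation) (m n : ℕ) (f : SCirc m n) →
    Σ[ x ∈ ℕ ] Σ[ g ∈ CCirc (x + m) (x + n) ] Σ[ s ∈ Vec V x ] Σ[ f′ ∈ SCirc m n ]
      (f ⇝[ Mealy ] f′ × f′ ⇝[ IF I ] Tr x ((reg s ⊗ id m) ⨾ ⌜ g ⌝))
theorem5p24 S I m n f =
  let open Circuits S
      x , y , z , v , f̂ , f≈ = NormalForm.toTraceDelayForm S f
      c , longest = longestChainLength S I x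
      s = replicate y (Signature.• S) ++ v
  -- There is one register for each of the `y` delays, with initial value `•`, and one for each of
  -- the `z` values. The combinational circuit and the intermediate circuit are read off from the
  -- rules by unification.
  in y + z , _ , s , _
   , (_ , _ , f≈ , here (mealy x y v f̂) , ≈-refl)
   , (_ , _ , split-Tr S x (reg s) _
     -- The unfolding acts below the outer trace and behind the registers, so only the undelayed
     -- feedback over `x` disappears.
     , tr (y + z) (⨾ʳ (reg s ⊗ id m) (here (unfold x _ longest))) , ≈-refl)
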